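{- Let $n\ge3$. The elements of $R$ whose binary representation has length $2n+7$ and begins with $100100$ are exactly $[100100(10)^{n-1}010]_2$ and $[100100(10)^n0]_2$.
   Context: Stern's sequence $(a(n))_{n\ge0}$: $a(0)=0$, $a(1)=1$, $a(2n)=a(n)$, $a(2n+1)=a(n)+a(n+1)$; $s(n)=a(n+1)$. $R$ is the set of record-setters of $s$, i.e. indices $v\ge0$ with $s(i)<s(v)$ for all $i<v$. Binary representations have no leading zeros. For a binary string $x$, $[x]_2$ is the integer it represents in base 2; $x^i$ denotes $i$-fold concatenation. -}

module Defs where

open import Data.Digit using (Bit; 0b; 1b; fromDigits)
open import Data.List.Base using (List; []; _∷_; head; reverse; concat; replicate)
open import Data.Maybe.Base using (just)
open import Data.Nat.Base using (ℕ; zero; suc; 2+; _+_; _*_; _<_; ⌊_/2⌋; ⌈_/2⌉; parity)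
open import Data.Nat.Induction using (Acc; acc; <-wellFounded)
open import Data.Nat.Properties using (⌊n/2⌋<n; ⌈n/2⌉<n; *-suc; +-suc; +-comm)
open import Data.Parity.Base using (Parity; 0ℙ; 1ℙ)
open import Data.Product.Base using (_×_)
open import Relation.Binary.PropositionalEquality using (_≡_; _≢_; refl; trans; cong; cong₂; module ≡-Reasoning)

combine : Parity → ℕ → ℕ → ℕ
combine 0ℙ x y = x
combine 1ℙ x y = x + y

aAcc : (n : ℕ) → Acc _<_ n → ℕ
aAcc 0      _        = 0
aAcc 1      _        = 1
aAcc (2+ m) (acc rs) = combine (parity (2+ m))
  (aAcc ⌊ 2+ m /2⌋ (rs (⌊n/2⌋<n (suc m))))
  (aAcc ⌈ 2+ m /2⌉ (rs (⌈n/2⌉<n m)))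

-- Stern's sequence; the defining recurrences are a-zero, a-one, a-even, a-odd below.
a : ℕ → ℕ
a n = aAcc n (<-wellFounded n)

aAcc-irr : ∀ n (p q : Acc _<_ n) → aAcc n p ≡ aAcc n q
aAcc-irr 0      _        _        = refl
aAcc-irr 1      _        _        = refl
aAcc-irr (2+ m) (acc rs) (acc rt) = cong₂ (combine (parity (2+ m)))
  (aAcc-irr ⌊ 2+ m /2⌋ (rs (⌊n/2⌋<n (suc m))) (rt (⌊n/2⌋<n (suc m))))
  (aAcc-irr ⌈ 2+ m /2⌉ (rs (⌈n/2⌉<n m)) (rt (⌈n/2⌉<n m)))

aAcc-step : ∀ m (p : Acc _<_ (2+ m)) →
  aAcc (2+ m) p ≡ combine (parity (2+ m)) (a ⌊ 2+ m /2⌋) (a ⌈ 2+ m /2⌉)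
aAcc-step m (acc rs) = cong₂ (combine (parity (2+ m)))
  (aAcc-irr ⌊ 2+ m /2⌋ (rs (⌊n/2⌋<n (suc m))) (<-wellFounded ⌊ 2+ m /2⌋))
  (aAcc-irr ⌈ 2+ m /2⌉ (rs (⌈n/2⌉<n m)) (<-wellFounded ⌈ 2+ m /2⌉))

a-step : ∀ m → a (2+ m) ≡ combine (parity (2+ m)) (a ⌊ 2+ m /2⌋) (a ⌈ 2+ m /2⌉)
a-step m = aAcc-step m (<-wellFounded (2+ m))

parity-2* : ∀ n → parity (2 * n) ≡ 0ℙ
parity-2* zero = refl
parity-2* (suc n) rewrite +-suc n (n + 0) = parity-2* n

parity-1+2* : ∀ n → parity (suc (2 * n)) ≡ 1ℙ
parity-1+2* zero = refl
parity-1+2* (suc n) rewrite +-suc n (n + 0) = parity-1+2* n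

⌊2*n/2⌋≡n : ∀ n → ⌊ 2 * n /2⌋ ≡ n
⌊2*n/2⌋≡n zero = refl
⌊2*n/2⌋≡n (suc n) rewrite +-suc n (n + 0) = cong suc (⌊2*n/2⌋≡n n)

⌊1+2*n/2⌋≡n : ∀ n → ⌊ suc (2 * n) /2⌋ ≡ n
⌊1+2*n/2⌋≡n zero = refl
⌊1+2*n/2⌋≡n (suc n) rewrite +-suc n (n + 0) = cong suc (⌊1+2*n/2⌋≡n n)

a-zero : a 0 ≡ 0
a-zero = refl

a-one : a 1 ≡ 1
a-one = refl

a-even : ∀ n → a (2 * n) ≡ a n
a-even zero    = refl
a-even (suc n) = trans (cong a (*-suc 2 n)) (trans (a-step (2 * n)) (begin
  combine (parity (2 * n)) (a (suc ⌊ 2 * n /2⌋)) y  ≡⟨ cong (λ p → combine p (a (suc ⌊ 2 * n /2⌋)) y) (parity-2* n) ⟩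
  a (suc ⌊ 2 * n /2⌋)                               ≡⟨ cong (λ k → a (suc k)) (⌊2*n/2⌋≡n n) ⟩
  a (suc n)                                         ∎))
  where
  open ≡-Reasoning
  y = a ⌈ 2+ (2 * n) /2⌉

a-odd : ∀ n → a (2 * n + 1) ≡ a n + a (n + 1)
a-odd n = trans (cong a (+-comm (2 * n) 1)) (trans (odd n) (cong (λ k → a n + a k) (+-comm 1 n)))
  where
  odd : ∀ n → a (suc (2 * n)) ≡ a n + a (suc n)
  odd zero    = refl
  odd (suc n) = trans (cong (λ k → a (suc k)) (*-suc 2 n)) (trans (a-step (suc (2 * n))) (trans
    (cong (λ p → combine p (a (suc ⌊ suc (2 * n) /2⌋)) (a (2+ ⌊ 2 * n /2⌋))) (parity-1+2* n))
    (cong₂ (λ k l → a (suc k) + a (2+ l)) (⌊1+2*n/2⌋≡n n) (⌊2*n/2⌋≡n n))))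

s : ℕ → ℕ
s n = a (n + 1)

-- R v means v ∈ R, the set of record-setters of s.
R : ℕ → Set
R v = ∀ i → i < v → s i < s v

-- Bit strings are written most significant bit first, whereas
-- fromDigits expects the least significant digit first.
[_]₂ : List Bit → ℕ
[ x ]₂ = fromDigits (reverse x)

-- x is the binary representation of v, without leading zeros
-- (so 0 is represented by the empty string).
_IsBinaryRepOf_ : List Bit → ℕ → Set
x IsBinaryRepOf v = ([ x ]₂ ≡ v) × (head x ≢ just 0b)

infixl 8 _^ʷ_

_^ʷ_ : List Bit → ℕ → List Bit
x ^ʷ i = concat (replicate i x)

w10 w010 w100100 : List Bit
w10     = 1b ∷ 0b ∷ []
w010    = 0b ∷ 1b ∷ 0b ∷ []
w100100 = 1b ∷ 0b ∷ 0b ∷ 1b ∷ 0b ∷ 0b ∷ []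

{-# OPTIONS --safe #-}
module Submission where

-- Appending a digit to N acts on the state (a(N), a(N+1)) by (p, q) ↦ (p, p+q) for 0 and
-- (p+q, q) for 1, and s is the second component.  If p, q ≤ h and p + q ≤ l + h, then r
-- further digits give at most F_r l + F_{r+1} h.  The state of 100100 is (4, 11), so this
-- bound, with r = 2n + 1, is attained by v₂ = 100100(10)^n 0.  Every smaller prefix obeys
-- the bound of (5, 9), the state of 100010, which 100010(10)^n 0 attains.  A word below
-- v₁ = v₂ − 2 with prefix 100100 replaces some 1 of v₁ by 0; as the ratios q/p along
-- 100100(10)^j exceed the golden ratio, its maximum grows with the position of that 1, and
-- even the last relevant one stays within the bound of (5, 9), while s(v₁) exceeds it.

open import Defs
open import Data.Digit using (Bit; 0b; 1b; fromDigits)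
open import Data.Empty using (⊥-elim)
open import Data.Fin.Base using (toℕ; zero; suc)
open import Data.List.Base using (List; []; _∷_; _++_; length; foldl)
open import Data.List.Relation.Binary.Prefix.Heterogeneous using (Prefix; []; _∷_)
open import Data.Nat.Base using (ℕ; zero; suc; _+_; _*_; _∸_; _≤_; _<_; ⌊_/2⌋; z≤n; s≤s; s≤s⁻¹)
open import Data.Nat.Properties
open import Data.Nat.Tactic.RingSolver using (solve-∀)
open import Data.Product.Base using (Σ-syntax; _×_; _,_)
open import Data.Sum.Base using (_⊎_; inj₁; inj₂)
open import Function.Base using (flip)
open import Function.Bundles using (_⇔_; mk⇔)
open import Relation.Binary.Definitions using (tri<; tri≈; tri>)
open import Relation.Binary.PropositionalEquality using (_≡_; _≢_; refl; sym; trans; cong; cong₂; subst; subst₂)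
open import Relation.Nullary.Negation using (¬_)
open import Relation.Nullary.Decidable using (toWitness; _×-dec_)

-- Stern's recurrences and binary digits.

a-double : ∀ N → a (N * 2) ≡ a N
a-double N = trans (cong a (*-comm N 2)) (a-even N)

a-1+double : ∀ N → a (1 + N * 2) ≡ a N + a (suc N)
a-1+double N = trans (cong a (trans (cong suc (*-comm N 2)) (+-comm 1 (2 * N))))
  (trans (a-odd N) (cong (λ k → a N + a k) (+-comm N 1)))

s≡a∘suc : ∀ i → s i ≡ a (suc i)
s≡a∘suc i = cong a (+-comm i 1)

⌊double/2⌋ : ∀ N → ⌊ N * 2 /2⌋ ≡ N
⌊double/2⌋ zero    = refl
⌊double/2⌋ (suc N) = cong suc (⌊double/2⌋ N)

⌊1+double/2⌋ : ∀ N → ⌊ 1 + N * 2 /2⌋ ≡ N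
⌊1+double/2⌋ zero    = refl
⌊1+double/2⌋ (suc N) = cong suc (⌊1+double/2⌋ N)

even⊎odd : ∀ M → M ≡ ⌊ M /2⌋ * 2 ⊎ M ≡ 1 + ⌊ M /2⌋ * 2
even⊎odd 0             = inj₁ refl
even⊎odd 1             = inj₂ refl
even⊎odd (suc (suc M)) with even⊎odd M
... | inj₁ eq = inj₁ (cong (2 +_) eq)
... | inj₂ eq = inj₂ (cong (2 +_) eq)

-- The equation `dropBits r i ≡ N` encodes that `i` is `N` followed by `r` binary digits.
dropBits : ℕ → ℕ → ℕ
dropBits zero    i = i
dropBits (suc r) i = ⌊ dropBits r i /2⌋

dropBits-mono : ∀ r {i j} → i ≤ j → dropBits r i ≤ dropBits r j
dropBits-mono zero    i≤j = i≤j
dropBits-mono (suc r) i≤j = ⌊n/2⌋-mono (dropBits-mono r i≤j)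

dropBits-cancel-< : ∀ r {i j} → dropBits r i < dropBits r j → i < j
dropBits-cancel-< r lt = ≰⇒> λ j≤i → <⇒≱ lt (dropBits-mono r j≤i)

dropBits-split : ∀ r {i N} → dropBits (suc r) i ≡ N →
  dropBits r i ≡ N * 2 ⊎ dropBits r i ≡ 1 + N * 2
dropBits-split r {i} refl = even⊎odd (dropBits r i)

append : ℕ → List Bit → ℕ
append N []      = N
append N (b ∷ w) = append (toℕ b + N * 2) w

⌊appendBit/2⌋ : ∀ (b : Bit) N → ⌊ toℕ b + N * 2 /2⌋ ≡ N
⌊appendBit/2⌋ zero       N = ⌊double/2⌋ N
⌊appendBit/2⌋ (suc zero) N = ⌊1+double/2⌋ N

dropBits-append : ∀ N w → dropBits (length w) (append N w) ≡ N
dropBits-append N []      = refl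
dropBits-append N (b ∷ w) =
  trans (cong ⌊_/2⌋ (dropBits-append (toℕ b + N * 2) w)) (⌊appendBit/2⌋ b N)

fromDigits-foldl : ∀ ds w → fromDigits (foldl (flip _∷_) ds w) ≡ append (fromDigits ds) w
fromDigits-foldl ds []      = refl
fromDigits-foldl ds (b ∷ w) = fromDigits-foldl (b ∷ ds) w

[]₂≡append : ∀ x → [ x ]₂ ≡ append 0 x
[]₂≡append = fromDigits-foldl []

-- The Fibonacci bound after r further digits.

-- fibFrom r l h = F_r l + F_{r+1} h for the Fibonacci numbers F.
fibFrom : ℕ → ℕ → ℕ → ℕ
fibFrom zero    l h = h
fibFrom (suc r) l h = fibFrom r h (h + l)

fibFrom-mono : ∀ r {l l′ h h′} → l ≤ l′ → h ≤ h′ → fibFrom r l h ≤ fibFrom r l′ h′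
fibFrom-mono zero    l≤ h≤ = h≤
fibFrom-mono (suc r) l≤ h≤ = fibFrom-mono r h≤ (+-mono-≤ h≤ l≤)

fibFrom-+ : ∀ r l h l′ h′ → fibFrom r (l + l′) (h + h′) ≡ fibFrom r l h + fibFrom r l′ h′
fibFrom-+ zero    l h l′ h′ = refl
fibFrom-+ (suc r) l h l′ h′ = trans
  (cong (fibFrom r (h + h′)) (+-interchange h h′ l l′))
  (fibFrom-+ r h (h + l) h′ (h′ + l′))
  where
  +-interchange : ∀ w x y z → (w + x) + (y + z) ≡ (w + y) + (x + z)
  +-interchange = solve-∀

-- After one digit, one component is an old one, the other is the old sum, and together they are at
-- most `(h + l) + h`; so the hypotheses recur with `h` and `h + l`.
a-suc≤fibFrom : ∀ r {i N l h} → dropBits r i ≡ N →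
  a N ≤ h → a (suc N) ≤ h → a (suc N) + a N ≤ h + l → a (suc i) ≤ fibFrom r l h
a-suc≤fibFrom zero    refl p≤h q≤h q+p≤h+l = q≤h
a-suc≤fibFrom (suc r) {i} {N} {l} {h} eq p≤h q≤h q+p≤h+l with dropBits-split r eq
... | inj₁ even = a-suc≤fibFrom r even
  (≤-trans (≤-reflexive (a-double N)) (≤-trans p≤h (m≤m+n h l)))
  (≤-trans (≤-reflexive a[1+2N]) q+p≤h+l)
  (≤-trans (≤-reflexive (cong₂ _+_ a[1+2N] (a-double N))) (+-mono-≤ q+p≤h+l p≤h))
  where
  a[1+2N] : a (1 + N * 2) ≡ a (suc N) + a N
  a[1+2N] = trans (a-1+double N) (+-comm (a N) (a (suc N)))
... | inj₂ odd = a-suc≤fibFrom r odd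
  (≤-trans (≤-reflexive a[1+2N]) q+p≤h+l)
  (≤-trans (≤-reflexive (a-double (suc N))) (≤-trans q≤h (m≤m+n h l)))
  (≤-trans (≤-reflexive (trans (cong₂ _+_ (a-double (suc N)) a[1+2N])
    (+-comm (a (suc N)) (a (suc N) + a N)))) (+-mono-≤ q+p≤h+l q≤h))
  where
  a[1+2N] : a (1 + N * 2) ≡ a (suc N) + a N
  a[1+2N] = trans (a-1+double N) (+-comm (a N) (a (suc N)))

-- The words (10)^t 0 and (10)^t 010.

append10 : ℕ → ℕ
append10 N = (1 + N * 2) * 2

a-append10 : ∀ N → a (append10 N) ≡ a (suc N) + a N
a-append10 N = trans (a-double (1 + N * 2)) (trans (a-1+double N) (+-comm (a N) (a (suc N))))

a-suc-append10 : ∀ N → a (suc (append10 N)) ≡ a (suc N) + a N + a (suc N)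
a-suc-append10 N = trans (a-1+double (1 + N * 2))
  (cong₂ _+_ (trans (a-1+double N) (+-comm (a N) (a (suc N)))) (a-double (suc N)))

10^_·0 10^_·010 : ℕ → List Bit
10^ t ·0   = w10 ^ʷ t ++ (0b ∷ [])
10^ t ·010 = w10 ^ʷ t ++ w010

-- fib010 t p q is the value of s at N(10)^t 010 if p = a(N), q = a(N+1).
fib010 : ℕ → ℕ → ℕ → ℕ
fib010 zero    p q = 3 * p + 2 * q
fib010 (suc t) p q = fib010 t (q + p) (q + p + q)

-- fibLastZero t p q = fibFrom 4 P (P + Q), with (P , Q) the state of
-- N(10)^t: the maximum of s over words N(10)^t 0 followed by four digits.
fibLastZero : ℕ → ℕ → ℕ → ℕ
fibLastZero zero    p q = fibFrom 4 p (p + q)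
fibLastZero (suc t) p q = fibLastZero t (q + p) (q + p + q)

-- The block 10 sends (p, q) to (q + p, q + p + q), which is two steps of `fibFrom`.
a-suc-10^·0 : ∀ t N → a (suc (append N (10^ t ·0))) ≡ fibFrom (t * 2 + 1) (a N) (a (suc N))
a-suc-10^·0 zero    N = trans (a-1+double N) (+-comm (a N) (a (suc N)))
a-suc-10^·0 (suc t) N = trans (a-suc-10^·0 t (append10 N))
  (cong₂ (fibFrom (t * 2 + 1)) (a-append10 N) (a-suc-append10 N))

a-suc-10^·010 : ∀ t N → a (suc (append N (10^ t ·010))) ≡ fib010 t (a N) (a (suc N))
a-suc-10^·010 zero N
  rewrite a-1+double (1 + N * 2 * 2) | a-double (suc (N * 2)) | a-1+double (N * 2)
        | a-double N | a-1+double N = 3p+2q (a N) (a (suc N))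
  where
  3p+2q : ∀ p q → p + (p + q) + (p + q) ≡ 3 * p + 2 * q
  3p+2q = solve-∀
a-suc-10^·010 (suc t) N = trans (a-suc-10^·010 t (append10 N))
  (cong₂ (fib010 t) (a-append10 N) (a-suc-append10 N))

-- The word ends in 0, so for its value v the number `a (suc v)` is a sum with `a (2 + v)` as a
-- summand. Hence `suc v` is no record.
a-2+-10^·010 : ∀ t N → a (2 + append N (10^ t ·010)) ≤ a (suc (append N (10^ t ·010)))
a-2+-10^·010 zero N
  rewrite a-double (suc (1 + N * 2 * 2)) | a-1+double (1 + N * 2 * 2) =
  m≤n+m (a (2 + N * 2 * 2)) _
a-2+-10^·010 (suc t) N = a-2+-10^·010 t (append10 N)

10^suc·0≡2+10^·010 : ∀ t N → append N (10^ suc t ·0) ≡ 2 + append N (10^ t ·010)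
10^suc·0≡2+10^·010 zero    N = refl
10^suc·0≡2+10^·010 (suc t) N = 10^suc·0≡2+10^·010 t (append10 N)

fib010<fibFrom : ∀ t {p q} → p < q → fib010 t p q < fibFrom (t * 2 + 3) p q
fib010<fibFrom zero {p} {q} p<q = subst₂ _<_ (lhs p q) (rhs p q) (+-monoʳ-< (2 * p + 2 * q) p<q)
  where
  lhs : ∀ p q → 2 * p + 2 * q + p ≡ 3 * p + 2 * q
  lhs = solve-∀
  rhs : ∀ p q → 2 * p + 2 * q + q ≡ (q + p) + q + (q + p)
  rhs = solve-∀
fib010<fibFrom (suc t) {p} {q} p<q = fib010<fibFrom t (m<m+n (q + p) (≤-trans (s≤s z≤n) p<q))

-- Comparison of the prefixes 100010 and 100100.

-- With x = F_{2j} and y = F_{2j-1}, the states (a(N), a(N+1)) of 100010(10)^j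
-- and 100100(10)^j are (9x + 5y , 14x + 9y) and (11x + 4y , 15x + 11y).
module _ (x y : ℕ) where
  low₁ low₂ high₁ high₂ : ℕ
  low₁  = 9 * x + 5 * y
  low₂  = 14 * x + 9 * y
  high₁ = 11 * x + 4 * y
  high₂ = 15 * x + 11 * y

-- Passing from (x, y) to (2x + y, x + y) raises j by one.
low₁-step : ∀ x y → low₁ (x + y + x) (x + y) ≡ low₂ x y + low₁ x y
low₁-step = unfolded
  where
  unfolded : ∀ x y → 9 * (x + y + x) + 5 * (x + y) ≡ 14 * x + 9 * y + (9 * x + 5 * y)
  unfolded = solve-∀

low₂-step : ∀ x y → low₂ (x + y + x) (x + y) ≡ low₂ x y + low₁ x y + low₂ x y
low₂-step = unfolded
  where
  unfolded : ∀ x y → 14 * (x + y + x) + 9 * (x + y) ≡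
    14 * x + 9 * y + (9 * x + 5 * y) + (14 * x + 9 * y)
  unfolded = solve-∀

high₁-step : ∀ x y → high₁ (x + y + x) (x + y) ≡ high₂ x y + high₁ x y
high₁-step = unfolded
  where
  unfolded : ∀ x y → 11 * (x + y + x) + 4 * (x + y) ≡ 15 * x + 11 * y + (11 * x + 4 * y)
  unfolded = solve-∀

high₂-step : ∀ x y → high₂ (x + y + x) (x + y) ≡ high₂ x y + high₁ x y + high₂ x y
high₂-step = unfolded
  where
  unfolded : ∀ x y → 15 * (x + y + x) + 11 * (x + y) ≡
    15 * x + 11 * y + (11 * x + 4 * y) + (15 * x + 11 * y)
  unfolded = solve-∀

-- For `t` = 0 the gap is 3(x - y), and `y < x` survives each block.
low<fib010-high : ∀ t x y → y < x →
  fibFrom (t * 2 + 3) (low₁ x y) (low₂ x y) < fib010 t (high₁ x y) (high₂ x y)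
low<fib010-high zero x y y<x =
  subst₂ _<_ (lhs x y) (rhs x y) (+-monoʳ-< (60 * x + 34 * y) (*-monoʳ-< 3 y<x))
  where
  lhs : ∀ x y → 60 * x + 34 * y + 3 * y ≡
    14 * x + 9 * y + (9 * x + 5 * y) + (14 * x + 9 * y) + (14 * x + 9 * y + (9 * x + 5 * y))
  lhs = solve-∀
  rhs : ∀ x y → 60 * x + 34 * y + 3 * x ≡ 3 * (11 * x + 4 * y) + 2 * (15 * x + 11 * y)
  rhs = solve-∀
low<fib010-high (suc t) x y y<x = subst₂ _<_
  (cong₂ (fibFrom (t * 2 + 3)) (low₁-step x y) (low₂-step x y))
  (cong₂ (fib010 t) (high₁-step x y) (high₂-step x y))
  (low<fib010-high t (x + y + x) (x + y) (m<m+n (x + y) (≤-trans (s≤s z≤n) y<x)))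

-- For `t` = 0 the gap is 2(5y - 3x). The hypothesis `x ≤ 2 * y` yields `3 * x ≤ 5 * y` one block
-- later.
fibLastZero-high≤low : ∀ t x y → x ≤ 2 * y → 3 * x ≤ 5 * y →
  fibLastZero t (high₁ x y) (high₂ x y) ≤ fibFrom (t * 2 + 5) (low₁ x y) (low₂ x y)
fibLastZero-high≤low zero x y _ 3x≤5y =
  subst₂ _≤_ (lhs x y) (rhs x y) (+-monoʳ-≤ (157 * x + 87 * y) (*-monoʳ-≤ 2 3x≤5y))
  where
  lhs₀ : ∀ p q → 8 * p + 5 * q ≡ fibFrom 4 p (p + q)
  lhs₀ = unfolded
    where
    unfolded : ∀ p q → 8 * p + 5 * q ≡
      p + q + p + (p + q) + (p + q + p) + (p + q + p + (p + q))
    unfolded = solve-∀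
  lhs₁ : ∀ x y → 157 * x + 87 * y + 2 * (3 * x) ≡ 8 * (11 * x + 4 * y) + 5 * (15 * x + 11 * y)
  lhs₁ = solve-∀
  lhs : ∀ x y → 157 * x + 87 * y + 2 * (3 * x) ≡ fibFrom 4 (high₁ x y) (high₁ x y + high₂ x y)
  lhs x y = trans (lhs₁ x y) (lhs₀ (high₁ x y) (high₂ x y))
  rhs₀ : ∀ l h → 5 * l + 8 * h ≡ fibFrom 5 l h
  rhs₀ = unfolded
    where
    unfolded : ∀ l h → 5 * l + 8 * h ≡
      h + l + h + (h + l) + (h + l + h) + (h + l + h + (h + l))
    unfolded = solve-∀
  rhs₁ : ∀ x y → 157 * x + 87 * y + 2 * (5 * y) ≡ 5 * (9 * x + 5 * y) + 8 * (14 * x + 9 * y)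
  rhs₁ = solve-∀
  rhs : ∀ x y → 157 * x + 87 * y + 2 * (5 * y) ≡ fibFrom 5 (low₁ x y) (low₂ x y)
  rhs x y = trans (rhs₁ x y) (rhs₀ (low₁ x y) (low₂ x y))
fibLastZero-high≤low (suc t) x y x≤2y _ = subst₂ _≤_
  (cong₂ (fibLastZero t) (high₁-step x y) (high₂-step x y))
  (cong₂ (fibFrom (t * 2 + 5)) (low₁-step x y) (low₂-step x y))
  (fibLastZero-high≤low t (x + y + x) (x + y)
    (subst (x + y + x ≤_) (2[x+y] x y) (m≤m+n (x + y + x) y))
    (subst₂ _≤_ (3x′ x y) (5y′ x y) (+-monoʳ-≤ (5 * x + 3 * y) x≤2y)))
  where
  2[x+y] : ∀ x y → x + y + x + y ≡ 2 * (x + y)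
  2[x+y] = solve-∀
  3x′ : ∀ x y → 5 * x + 3 * y + x ≡ 3 * (x + y + x)
  3x′ = solve-∀
  5y′ : ∀ x y → 5 * x + 3 * y + 2 * y ≡ 5 * (x + y)
  5y′ = solve-∀

-- The golden ratio and the position of the first changed digit.

-- F_{2k+2} p ≤ F_{2k+1} q for all k; in the limit, q / p is at least the golden ratio.
GoldenRatio≤ : ℕ → ℕ → Set
GoldenRatio≤ p q = ∀ k → fibFrom (k * 2) p p ≤ fibFrom (k * 2) 0 q

-- At `suc k` both sides share a part with starting pair (p + 2q, 2p + 3q); removing it leaves the
-- hypothesis at `k`.
GoldenRatio≤-step : ∀ {p q} → GoldenRatio≤ p q → GoldenRatio≤ (q + p) (q + p + q)
GoldenRatio≤-step {p} {q} φ zero    = m≤m+n (q + p) q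
GoldenRatio≤-step {p} {q} φ (suc k) = subst₂ _≤_
  (trans (sym (fibFrom-+ (k * 2) (p + 2 * q) (2 * p + 3 * q) p p))
    (cong₂ (fibFrom (k * 2)) (lhs₁ p q) (lhs₂ p q)))
  (trans (sym (fibFrom-+ (k * 2) (p + 2 * q) (2 * p + 3 * q) 0 q))
    (cong₂ (fibFrom (k * 2)) (rhs₁ p q) (rhs₂ p q)))
  (+-monoʳ-≤ (fibFrom (k * 2) (p + 2 * q) (2 * p + 3 * q)) (φ k))
  where
  lhs₁ : ∀ p q → p + 2 * q + p ≡ q + p + (q + p)
  lhs₁ = solve-∀
  lhs₂ : ∀ p q → 2 * p + 3 * q + p ≡ q + p + (q + p) + (q + p)
  lhs₂ = solve-∀
  rhs₁ : ∀ p q → p + 2 * q + 0 ≡ q + p + q + 0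
  rhs₁ = solve-∀
  rhs₂ : ∀ p q → 2 * p + 3 * q + q ≡ q + p + q + 0 + (q + p + q)
  rhs₂ = solve-∀

goldenRatio≤-4-11 : GoldenRatio≤ 4 11
goldenRatio≤-4-11 zero    = m≤m+n 4 7
-- Two steps turn (4, 4) and (0, 11) into (8, 12) and (11, 22).
goldenRatio≤-4-11 (suc k) = fibFrom-mono (k * 2) (m≤m+n 8 3) (m≤m+n 12 10)

-- Among the words leaving (10)^t 010 by a 0 in place of a 1, the later ones have larger maxima.
fibFrom≤fibLastZero : ∀ t {p q} → GoldenRatio≤ p q →
  fibFrom (t * 2 + 4) p (p + q) ≤ fibLastZero t p q
fibFrom≤fibLastZero zero    φ = ≤-refl
fibFrom≤fibLastZero (suc t) {p} {q} φ = ≤-trans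
  (subst₂ _≤_
    (trans (sym (fibFrom-+ r (q + p) (2 * p + 2 * q) p p))
      (cong₂ (fibFrom r) (lhs₁ p q) (lhs₂ p q)))
    (trans (sym (fibFrom-+ r (q + p) (2 * p + 2 * q) 0 q))
      (cong₂ (fibFrom r) (rhs₁ p q) (rhs₂ p q)))
    -- Without this common part, the starting pairs (2p + q, 3p + 2q) and (p + q, 2p + 3q) become
    -- (p, p) and (0, q), which `φ` compares.
    (+-monoʳ-≤ (fibFrom r (q + p) (2 * p + 2 * q))
      (subst (λ r → fibFrom r p p ≤ fibFrom r 0 q) (even t) (φ (t + 2)))))
  (fibFrom≤fibLastZero t (GoldenRatio≤-step φ))
  where
  r : ℕ
  r = t * 2 + 4
  even : ∀ t → (t + 2) * 2 ≡ t * 2 + 4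
  even = solve-∀
  lhs₁ : ∀ p q → q + p + p ≡ p + q + p
  lhs₁ = solve-∀
  lhs₂ : ∀ p q → 2 * p + 2 * q + p ≡ p + q + p + (p + q)
  lhs₂ = solve-∀
  rhs₁ : ∀ p q → q + p + 0 ≡ q + p
  rhs₁ = solve-∀
  rhs₂ : ∀ p q → 2 * p + 2 * q + q ≡ q + p + (q + p + q)
  rhs₂ = solve-∀

-- Words below N(10)^t 010.

<append0⇒dropBits : ∀ w {i N} → dropBits (1 + length w) i ≡ N → i < append N (0b ∷ w) →
  dropBits (length w) i ≡ N * 2
<append0⇒dropBits w {i} {N} eq i< with dropBits-split (length w) eq
... | inj₁ even = even
-- A digit 1 after `N` would put `i` above the word.
... | inj₂ odd  = ⊥-elim (<-irrefl refl (begin-strict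
  1 + N * 2                                 ≡⟨ odd ⟨
  dropBits (length w) i                     ≤⟨ dropBits-mono (length w) (<⇒≤ i<) ⟩
  dropBits (length w) (append (N * 2) w)    ≡⟨ dropBits-append (N * 2) w ⟩
  N * 2                                     <⟨ n<1+n (N * 2) ⟩
  1 + N * 2                                 ∎))
  where open ≤-Reasoning

length-10^· : ∀ t u → length (w10 ^ʷ t ++ u) ≡ t * 2 + length u
length-10^· zero    u = refl
length-10^· (suc t) u = cong (2 +_) (length-10^· t u)

a-suc≤fibFrom-0 : ∀ r {i} N → dropBits r i ≡ N * 2 →
  a (suc i) ≤ fibFrom r (a N) (a N + a (suc N))
a-suc≤fibFrom-0 r N eq = a-suc≤fibFrom r eq
  (≤-trans (≤-reflexive (a-double N)) (m≤m+n (a N) (a (suc N))))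
  (≤-reflexive (a-1+double N))
  (≤-reflexive (cong₂ _+_ (a-1+double N) (a-double N)))

<010⇒a-suc≤ : ∀ {i N} → dropBits 3 i ≡ N → i < append N w010 → a (suc i) ≤ 3 * a N + a (suc N)
<010⇒a-suc≤ {i} {N} eq i< with dropBits-split 1 (<append0⇒dropBits (1b ∷ 0b ∷ []) eq i<)
... | inj₁ even = ≤-trans (a-suc≤fibFrom-0 1 (N * 2) even)
  (≤-reflexive (trans (cong (λ k → a (N * 2) + k + a (N * 2)) (a-1+double N))
    (trans (cong (λ k → k + (a N + a (suc N)) + k) (a-double N)) (3p+q (a N) (a (suc N))))))
  where
  3p+q : ∀ p q → p + (p + q) + p ≡ 3 * p + q
  3p+q = solve-∀
-- After N01 the last digit would have to be 0, making `i` the word N010 itself.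
... | inj₂ odd = ⊥-elim (<-irrefl (<append0⇒dropBits [] odd i<) i<)

-- Either the leading 1 becomes 0, or `i` keeps the block 10 and the induction moves past it. Once
-- only 010 remains, the bound of `<010⇒a-suc≤` is smaller by `4 * a N`.
<10^·010⇒a-suc≤ : ∀ t {i N} → GoldenRatio≤ (a N) (a (suc N)) →
  dropBits (suc t * 2 + 3) i ≡ N → i < append N (10^ suc t ·010) →
  a (suc i) ≤ fibLastZero t (a N) (a (suc N))
<10^·010⇒a-suc≤ t {i} {N} φ eq i< with dropBits-split (suc (t * 2 + 3)) eq
... | inj₁ even = ≤-trans
  (a-suc≤fibFrom-0 (t * 2 + 4) N (trans (cong (λ r → dropBits r i) (+-suc (t * 2) 3)) even))
  (fibFrom≤fibLastZero t φ)
... | inj₂ odd = descend t φ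
  (subst (λ r → dropBits r i ≡ append10 N) (length-10^· t w010)
    (<append0⇒dropBits (10^ t ·010)
      (trans (cong (λ r → dropBits (suc r) i) (length-10^· t w010)) odd) i<))
  i<
  where
  descend : ∀ t → GoldenRatio≤ (a N) (a (suc N)) →
    dropBits (t * 2 + 3) i ≡ append10 N → i < append (append10 N) (10^ t ·010) →
    a (suc i) ≤ fibLastZero t (a N) (a (suc N))
  descend zero φ eq′ i<′ = ≤-trans (<010⇒a-suc≤ eq′ i<′)
    (≤-trans (≤-reflexive (cong₂ (λ p q → 3 * p + q) (a-append10 N) (a-suc-append10 N)))
      (subst (3 * (a (suc N) + a N) + (a (suc N) + a N + a (suc N)) ≤_) (4p+ (a N) (a (suc N)))
        (m≤m+n _ (4 * a N))))
    where
    4p+ : ∀ p q → 3 * (q + p) + (q + p + q) + 4 * p ≡ fibFrom 4 p (p + q)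
    4p+ = unfolded
      where
      unfolded : ∀ p q → 3 * (q + p) + (q + p + q) + 4 * p ≡
        p + q + p + (p + q) + (p + q + p) + (p + q + p + (p + q))
      unfolded = solve-∀
  descend (suc t) φ eq′ i<′ = subst (a (suc i) ≤_)
    (cong₂ (fibLastZero t) (a-append10 N) (a-suc-append10 N))
    (<10^·010⇒a-suc≤ t
      (subst₂ GoldenRatio≤ (sym (a-append10 N)) (sym (a-suc-append10 N)) (GoldenRatio≤-step φ))
      eq′ i<′)

-- The records with prefix 100100.

R⇒a-suc< : ∀ {v} → R v → ∀ {i} → i < v → a (suc i) < a (suc v)
R⇒a-suc< {v} Rv {i} i<v = subst₂ _<_ (s≡a∘suc i) (s≡a∘suc v) (Rv i i<v)

a-suc<⇒R : ∀ {v} → (∀ {i} → i < v → a (suc i) < a (suc v)) → R v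
a-suc<⇒R {v} lt i i<v = subst₂ _<_ (sym (s≡a∘suc i)) (sym (s≡a∘suc v)) (lt i<v)

≡⊎≡2+ : ∀ {v v₁ v₂} → v₂ ≡ 2 + v₁ → ¬ v < v₁ → v ≢ suc v₁ → ¬ v₂ < v → v ≡ v₁ ⊎ v ≡ v₂
≡⊎≡2+ {v} {v₁} refl v≮v₁ v≢1+v₁ v₂≮v with m≤n⇒m<n∨m≡n (≮⇒≥ v≮v₁)
... | inj₂ v₁≡v = inj₁ (sym v₁≡v)
... | inj₁ v₁<v = inj₂ (≤-antisym (≮⇒≥ v₂≮v) (≤∧≢⇒< v₁<v λ eq → v≢1+v₁ (sym eq)))

module _ (u : ℕ) where
  -- Here n = 3 + u, and `m` = 2n + 1 digits follow the prefix 100100, whose value is 36.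
  m : ℕ
  m = (2 + u) * 2 + 3

  v₁ v₂ bound : ℕ
  v₁    = append 36 (10^ 2 + u ·010)
  v₂    = append 36 (10^ 3 + u ·0)
  bound = fibFrom m 5 9

  v₂≡2+v₁ : v₂ ≡ 2 + v₁
  v₂≡2+v₁ = 10^suc·0≡2+10^·010 (2 + u) 36

  dropBits-v₁ : dropBits m v₁ ≡ 36
  dropBits-v₁ = subst (λ r → dropBits r v₁ ≡ 36) (length-10^· (2 + u) w010)
    (dropBits-append 36 (10^ 2 + u ·010))

  [3+u]*2+1≡m : (3 + u) * 2 + 1 ≡ m
  [3+u]*2+1≡m = cong (4 +_) (sym (trans (+-suc (u * 2) 2) (cong suc (+-suc (u * 2) 1))))

  length-10^·0 : length (10^ 3 + u ·0) ≡ m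
  length-10^·0 = trans (length-10^· (3 + u) (0b ∷ [])) [3+u]*2+1≡m

  dropBits<36⇒a-suc≤bound : ∀ {i} → dropBits m i < 36 → a (suc i) ≤ bound
  dropBits<36⇒a-suc≤bound lt with table lt
    where
    -- These are the hypotheses of the Fibonacci bound for l = 5, h = 9; prefixes below 32 account
    -- for the shorter `i`.
    table : ∀ {N} → N < 36 → a N ≤ 9 × a (suc N) ≤ 9 × a (suc N) + a N ≤ 14
    table = toWitness {a? = allUpTo? (λ N → (a N ≤? 9) ×-dec (a (suc N) ≤? 9)
      ×-dec (a (suc N) + a N ≤? 14)) 36} _
  ... | p≤9 , q≤9 , q+p≤14 = a-suc≤fibFrom m refl p≤9 q≤9 q+p≤14

  <v₁⇒a-suc≤bound : ∀ {i} → i < v₁ → a (suc i) ≤ bound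
  <v₁⇒a-suc≤bound {i} i<v₁ with m≤n⇒m<n∨m≡n (dropBits-mono m (<⇒≤ i<v₁))
  ... | inj₁ lt = dropBits<36⇒a-suc≤bound (subst (dropBits m i <_) dropBits-v₁ lt)
  ... | inj₂ eq = ≤-trans
    (<10^·010⇒a-suc≤ (1 + u) goldenRatio≤-4-11 (trans eq dropBits-v₁) i<v₁)
    -- With one block absorbed, (15, 26) and (14, 23) are the states of 10010010 and 10001010, so x
    -- = y = 1.
    (subst (fibLastZero u 15 26 ≤_)
      (cong (λ r → fibFrom r 14 23) (trans (+-suc (u * 2) 4) (cong suc (+-suc (u * 2) 3))))
      (fibLastZero-high≤low u 1 1 (m≤m+n 1 1) (m≤m+n 3 2)))

  bound<a-suc-v₁ : bound < a (suc v₁)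
  bound<a-suc-v₁ = subst (bound <_) (sym (a-suc-10^·010 (2 + u) 36))
    -- Two blocks are absorbed: x = F_4 = 3, y = F_3 = 2. This is where n ≥ 3 enters: for n = 2 only
    -- x = y = 1 is reached, and both sides equal 97.
    (low<fib010-high u 3 2 (m≤m+n 3 0))

  a-suc-v₂ : a (suc v₂) ≡ fibFrom m 4 11
  a-suc-v₂ = trans (a-suc-10^·0 (3 + u) 36) (cong (λ r → fibFrom r 4 11) [3+u]*2+1≡m)

  a-suc-v₁<a-suc-v₂ : a (suc v₁) < a (suc v₂)
  a-suc-v₁<a-suc-v₂ = subst₂ _<_ (sym (a-suc-10^·010 (2 + u) 36)) (sym a-suc-v₂)
    (fib010<fibFrom (2 + u) (m≤m+n 5 6))

  dropBits≡36⇒a-suc≤a-suc-v₂ : ∀ {i} → dropBits m i ≡ 36 → a (suc i) ≤ a (suc v₂)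
  dropBits≡36⇒a-suc≤a-suc-v₂ {i} eq = subst (a (suc i) ≤_) (sym a-suc-v₂)
    (a-suc≤fibFrom m eq (m≤m+n 4 7) ≤-refl ≤-refl)

  -- The witness is 100010(10)^n 0, with prefix value 34 < 36; it prevents a `v` with prefix 100100
  -- and `a (suc v) ≤ bound` from being a record.
  a-suc≡bound : ∀ {v} → dropBits m v ≡ 36 → Σ[ i ∈ ℕ ] (i < v × a (suc i) ≡ bound)
  a-suc≡bound {v} eq = i
    , dropBits-cancel-< m (subst₂ _<_ (sym dropBits-i) (sym eq) (m≤m+n 35 1))
    , trans (a-suc-10^·0 (3 + u) 34) (cong (λ r → fibFrom r 5 9) [3+u]*2+1≡m)
    where
    i : ℕ
    i = append 34 (10^ 3 + u ·0)
    dropBits-i : dropBits m i ≡ 34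
    dropBits-i = subst (λ r → dropBits r i ≡ 34) length-10^·0 (dropBits-append 34 (10^ 3 + u ·0))

  R-v₁ : R v₁
  R-v₁ = a-suc<⇒R λ i<v₁ → ≤-<-trans (<v₁⇒a-suc≤bound i<v₁) bound<a-suc-v₁

  R-v₂ : R v₂
  R-v₂ = a-suc<⇒R λ {i} i<v₂ → ≤-<-trans (≤a-suc-v₁ (s≤s⁻¹ (subst (i <_) v₂≡2+v₁ i<v₂))) a-suc-v₁<a-suc-v₂
    where
    ≤a-suc-v₁ : ∀ {i} → i ≤ 1 + v₁ → a (suc i) ≤ a (suc v₁)
    ≤a-suc-v₁ {i} i≤ with <-cmp i v₁
    ... | tri< i<v₁ _ _ = <⇒≤ (≤-<-trans (<v₁⇒a-suc≤bound i<v₁) bound<a-suc-v₁)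
    ... | tri≈ _ refl _ = ≤-refl
    ... | tri> _ _ v₁<i = subst (λ k → a (suc k) ≤ a (suc v₁)) (≤-antisym v₁<i i≤)
      (a-2+-10^·010 (2 + u) 36)

  R∧dropBits≡36⇒v₁⊎v₂ : ∀ {v} → R v → dropBits m v ≡ 36 → v ≡ v₁ ⊎ v ≡ v₂
  R∧dropBits≡36⇒v₁⊎v₂ {v} Rv eq = ≡⊎≡2+ v₂≡2+v₁ ≮v₁ ≢1+v₁ ≯v₂
    where
    ≮v₁ : ¬ v < v₁
    ≮v₁ v<v₁ = let i , i<v , a≡bound = a-suc≡bound eq in <⇒≱ (R⇒a-suc< Rv i<v)
      (subst (a (suc v) ≤_) (sym a≡bound) (<v₁⇒a-suc≤bound v<v₁))
    ≢1+v₁ : v ≢ suc v₁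
    ≢1+v₁ v≡1+v₁ = <⇒≱ (R⇒a-suc< Rv (≤-reflexive (sym v≡1+v₁)))
      (subst (λ k → a (suc k) ≤ a (suc v₁)) (sym v≡1+v₁) (a-2+-10^·010 (2 + u) 36))
    ≯v₂ : ¬ v₂ < v
    ≯v₂ v₂<v = <⇒≱ (R⇒a-suc< Rv v₂<v) (dropBits≡36⇒a-suc≤a-suc-v₂ eq)

  -- Translation to binary representations.

  6+m : 2 * (3 + u) + 7 ≡ 6 + m
  6+m = unfolded u
    where
    unfolded : ∀ u → 2 * (3 + u) + 7 ≡ 6 + ((2 + u) * 2 + 3)
    unfolded = solve-∀

  record⇒v₁⊎v₂ : ∀ {v} → R v → ∀ x → x IsBinaryRepOf v → length x ≡ 2 * (3 + u) + 7 →
    Prefix _≡_ w100100 x → v ≡ v₁ ⊎ v ≡ v₂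
  record⇒v₁⊎v₂ Rv (_ ∷ _ ∷ _ ∷ _ ∷ _ ∷ _ ∷ w) ([x]₂≡v , _) len
    (refl ∷ refl ∷ refl ∷ refl ∷ refl ∷ refl ∷ []) = R∧dropBits≡36⇒v₁⊎v₂ Rv
    (trans (cong₂ dropBits (sym (+-cancelˡ-≡ 6 _ _ (trans len 6+m)))
        (trans (sym [x]₂≡v) ([]₂≡append (w100100 ++ w))))
      (dropBits-append 36 w))

  binaryRep-100100 : ∀ w → length w ≡ m →
    Σ[ x ∈ List Bit ] (x IsBinaryRepOf append 36 w × length x ≡ 2 * (3 + u) + 7 × Prefix _≡_ w100100 x)
  binaryRep-100100 w len = w100100 ++ w
    , ([]₂≡append (w100100 ++ w) , λ ())
    , trans (cong (6 +_) len) (sym 6+m)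
    , refl ∷ refl ∷ refl ∷ refl ∷ refl ∷ refl ∷ []

mainTheorem18 : (n : ℕ) → 3 ≤ n → (v : ℕ) →
    (R v × (Σ[ x ∈ List Bit ] (x IsBinaryRepOf v × length x ≡ 2 * n + 7 × Prefix _≡_ w100100 x)))
    ⇔ (v ≡ [ w100100 ++ w10 ^ʷ (n ∸ 1) ++ w010 ]₂ ⊎ v ≡ [ w100100 ++ w10 ^ʷ n ++ (0b ∷ []) ]₂)
mainTheorem18 (suc (suc (suc u))) (s≤s (s≤s (s≤s z≤n))) v
  rewrite []₂≡append (w100100 ++ 10^ 2 + u ·010) | []₂≡append (w100100 ++ 10^ 3 + u ·0) =
  mk⇔ (λ { (Rv , x , rep , len , pre) → record⇒v₁⊎v₂ u Rv x rep len pre })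
      (λ { (inj₁ refl) → R-v₁ u , binaryRep-100100 u (10^ 2 + u ·010) (length-10^· (2 + u) w010)
         ; (inj₂ refl) → R-v₂ u , binaryRep-100100 u (10^ 3 + u ·0) (length-10^·0 u) })
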